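{- Let $m$ and $s$ be positive integers, and let the numbers $a(\cdot,\cdot)$, indexed by pairs of non-negative integers, be defined recursively by $a(m,0)=a(0,s)=1$ for all non-negative integers $m,s$ and $a(m,s)=a(m-1,s)+a(m,s-1)+a(m-1,s-1)$ for all positive integers $m,s$. Then: 1. $$a(m,s)=\sum_{k=0}^s \binom{s}{k}\binom{m}{k}2^k.$$ 2. If $G$ is a finite abelian group of order $n$ that contains an $s$-spanning set of size $m$, then $n\le a(m,s)$.
   Context: Let $G$ be a finite abelian group written additively, $s$ a non-negative integer, and $A=\{a_1,\dots,a_m\}$ a subset of $G$ of size $m$. $A$ is an $s$-spanning set in $G$ if every $g\in G$ can be written as $g=\lambda_1a_1+\lambda_2a_2+\cdots+\lambda_m a_m$ for some integers $\lambda_1,\dots,\lambda_m$ with $|\lambda_1|+|\lambda_2|+\cdots+|\lambda_m|\le s$. -}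

module Defs where

open import Algebra.Bundles using (AbelianGroup)
import Algebra.Definitions.RawMonoid as RawMonoid
open import Data.Fin.Base using (Fin)
open import Data.Integer.Base using (ℤ; +_; -[1+_]; ∣_∣)
open import Data.List.Base using (applyUpTo; sum)
open import Data.Nat.Base using (ℕ; zero; suc; _+_; _≤_; +-0-rawMonoid)
open import Data.Product.Base using (_×_; ∃-syntax)
open import Data.Vec.Functional using (Vector)
open import Function.Bundles using (Bijection)
open import Function.Definitions using (Injective)
open import Level using (_⊔_)
open import Relation.Binary.PropositionalEquality as ≡ using (_≡_)

a : ℕ → ℕ → ℕ
a zero    s       = 1
a (suc m) zero    = 1
a (suc m) (suc s) = a m (suc s) + a (suc m) s + a m s

Σ[0≤k≤_] : ℕ → (ℕ → ℕ) → ℕ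
Σ[0≤k≤ s ] f = sum (applyUpTo f (suc s))

∥_∥₁ : ∀ {m} → Vector ℤ m → ℕ
∥ c ∥₁ = RawMonoid.sum +-0-rawMonoid (λ i → ∣ c i ∣)

module _ {c ℓ} (G : AbelianGroup c ℓ) where
  open AbelianGroup G
  open RawMonoid rawMonoid using () renaming (_×_ to _ℕ·_; sum to ∑)

  infixr 8 _·_

  _·_ : ℤ → Carrier → Carrier
  (+ n)    · x = n ℕ· x
  -[1+ n ] · x = (suc n ℕ· x) ⁻¹

  linearCombination : ∀ {m} → Vector ℤ m → Vector Carrier m → Carrier
  linearCombination coeff x = ∑ (λ i → coeff i · x i)

  -- Elements are counted up to the group's equality _≈_.
  HasOrder : ℕ → Set (c ⊔ ℓ)
  HasOrder n = Bijection (≡.setoid (Fin n)) setoid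

  Spans : ∀ {m} → ℕ → Vector Carrier m → Set (c ⊔ ℓ)
  Spans {m} s x =
    ∀ g → ∃[ coeff ] (∥ coeff ∥₁ ≤ s × g ≈ linearCombination coeff x)

  -- A subset of size m is given by an enumeration x₁, …, xₘ of its elements
  -- without repetition.
  HasSpanningSet : (s m : ℕ) → Set (c ⊔ ℓ)
  HasSpanningSet s m =
    ∃[ x ] (Injective {A = Fin m} _≡_ _≈_ x × Spans s x)

{-# OPTIONS --safe #-}

-- By Pascal's rule the binomial sum satisfies the recursion of a, up to a
-- telescoping error; all sums are compared over a common range.
-- The combinations of an s-spanning set are indexed by the integer points of the
-- ℓ¹-ball of radius s, so it suffices to list these with a m s entries. For
-- dimension m + 1 and radius s + 1, the first coordinate is 0 (leaving a point
-- for m and s + 1), or -1 (leaving a point for m and s), or one can subtract 1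
-- if it is positive and add 1 if it is below -1. The sign (with 0 counted as
-- nonnegative) is then preserved, so the step is reversible, and the result is
-- an arbitrary point for m + 1 and s.
module Submission where

open import Defs
open import Algebra.Bundles using (AbelianGroup)
import Algebra.Properties.Monoid.Sum as MonoidSum
open import Data.Fin.Base using (Fin)
open import Data.Fin.Properties using (injective⇒≤)
open import Data.Integer.Base as ℤ using (ℤ; -[1+_]; +0; +[1+_]; ∣_∣; 0ℤ; -1ℤ)
open import Data.List.Base using (List; [_]; _++_; length; map; applyUpTo)
open import Data.List.Membership.Propositional using (_∈_)
open import Data.List.Membership.Propositional.Properties using (∈-map⁺; ∈-++⁺ˡ; ∈-++⁺ʳ)
open import Data.List.Membership.Setoid.Properties using (index-injective)
open import Data.List.Properties using (length-++; length-map; applyUpTo-∷ʳ)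
open import Data.List.Relation.Unary.Any using (here; index)
open import Data.Nat.Base using (ℕ; zero; suc; _+_; _*_; _^_; _≤_; s≤s; NonZero)
open import Data.Nat.Combinatorics using (_C_; nCk+nC[k+1]≡[n+1]C[k+1]; k>n⇒nCk≡0)
open import Data.Nat.ListAction using (sum)
open import Data.Nat.ListAction.Properties using (sum-++)
open import Data.Nat.Properties
open import Data.Nat.Tactic.RingSolver using (solve-∀)
open import Data.Product.Base using (_×_; _,_; proj₁; proj₂; ∃-syntax)
open import Data.Vec.Base using (Vec; []; _∷_; lookup; tabulate)
open import Data.Vec.Properties using (lookup∘tabulate)
open import Function.Base using (_∘_)
open import Function.Bundles using (Bijection)
open import Level using (Level)
open import Relation.Binary.PropositionalEquality
  using (_≡_; refl; sym; trans; cong; cong₂; subst; setoid; module ≡-Reasoning)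

private
  variable
    m n s : ℕ

Σ-last : ∀ n f → Σ[0≤k≤ suc n ] f ≡ Σ[0≤k≤ n ] f + f (suc n)
Σ-last n f = begin
  sum (applyUpTo f (2 + n))                  ≡⟨ cong sum (applyUpTo-∷ʳ f (suc n)) ⟨
  sum (applyUpTo f (suc n) ++ [ f (suc n) ]) ≡⟨ sum-++ (applyUpTo f (suc n)) _ ⟩
  Σ[0≤k≤ n ] f + (f (suc n) + 0)             ≡⟨ cong (Σ[0≤k≤ n ] f +_) (+-identityʳ _) ⟩
  Σ[0≤k≤ n ] f + f (suc n)                   ∎
  where open ≡-Reasoning

term : ℕ → ℕ → ℕ → ℕ
term m s k = (s C k) * (m C k) * 2 ^ k

-- Applying Pascal's rule to both binomials shows that the recursion of `a` fails termwise only by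
-- `2 * term m s k` minus `2 * term m s (suc k)`. The negative part stands on the left to avoid
-- subtraction in ℕ.
term-pascal : ∀ m s k →
  term (suc m) (suc s) (suc k) + 2 * term m s (suc k) ≡
  2 * term m s k + (term m (suc s) (suc k) + term (suc m) s (suc k) + term m s (suc k))
term-pascal m s k
  rewrite sym (nCk+nC[k+1]≡[n+1]C[k+1] m k) | sym (nCk+nC[k+1]≡[n+1]C[k+1] s k)
  = expand (m C k) (m C suc k) (s C k) (s C suc k) (2 ^ k)
  where
  expand : ∀ x x′ y y′ p →
    (y + y′) * (x + x′) * (2 * p) + 2 * (y′ * x′ * (2 * p)) ≡
    2 * (y * x * p) + ((y + y′) * x′ * (2 * p) + y′ * (x + x′) * (2 * p) + y′ * x′ * (2 * p))
  expand = solve-∀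

-- Adding up the steps cancels each `2 * t k` against the next one, so only the last, `2 * t n`,
-- survives.
Σ-telescope : ∀ (l x y t : ℕ → ℕ) →
  l 0 + 2 * t 0 ≡ x 0 + y 0 + t 0 →
  (∀ k → l (suc k) + 2 * t (suc k) ≡ 2 * t k + (x (suc k) + y (suc k) + t (suc k))) →
  ∀ n → Σ[0≤k≤ n ] l + 2 * t n ≡ Σ[0≤k≤ n ] x + Σ[0≤k≤ n ] y + Σ[0≤k≤ n ] t
Σ-telescope l x y t base step zero
  rewrite +-identityʳ (l 0) | +-identityʳ (x 0) | +-identityʳ (y 0) | +-identityʳ (t 0) = base
Σ-telescope l x y t base step (suc n)
  rewrite Σ-last n l | Σ-last n x | Σ-last n y | Σ-last n t = begin
  L + l′ + 2 * t′                     ≡⟨ +-assoc L l′ (2 * t′) ⟩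
  L + (l′ + 2 * t′)                   ≡⟨ cong (L +_) (step n) ⟩
  L + (2 * t n + (x′ + y′ + t′))      ≡⟨ +-assoc L (2 * t n) (x′ + y′ + t′) ⟨
  L + 2 * t n + (x′ + y′ + t′)        ≡⟨ cong (_+ (x′ + y′ + t′)) (Σ-telescope l x y t base step n) ⟩
  X + Y + T + (x′ + y′ + t′)          ≡⟨ regroup X Y T x′ y′ t′ ⟩
  (X + x′) + (Y + y′) + (T + t′)      ∎
  where
  open ≡-Reasoning
  L = Σ[0≤k≤ n ] l
  X = Σ[0≤k≤ n ] x
  Y = Σ[0≤k≤ n ] y
  T = Σ[0≤k≤ n ] t
  l′ = l (suc n)
  x′ = x (suc n)
  y′ = y (suc n)
  t′ = t (suc n)
  regroup : ∀ a b c d e f → a + b + c + (d + e + f) ≡ (a + d) + (b + e) + (c + f)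
  regroup = solve-∀

Σ-pascal : ∀ m s n →
  Σ[0≤k≤ n ] (term (suc m) (suc s)) + 2 * term m s n ≡
  Σ[0≤k≤ n ] (term m (suc s)) + Σ[0≤k≤ n ] (term (suc m) s) + Σ[0≤k≤ n ] (term m s)
Σ-pascal m s = Σ-telescope
  -- At k = 0 every term is 1, so the base case reads 1 + 2 = 1 + 1 + 1.
  (term (suc m) (suc s)) (term m (suc s)) (term (suc m) s) (term m s) refl (term-pascal m s)

term-above : ∀ m s → term m s (suc s) ≡ 0
term-above m s rewrite k>n⇒nCk≡0 (n<1+n s) = refl

-- The recursion mixes `s` and `suc s`; this brings the sums for `s` to the longer range.
Σ-above : ∀ m s → Σ[0≤k≤ suc s ] (term m s) ≡ Σ[0≤k≤ s ] (term m s)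
Σ-above m s = begin
  Σ[0≤k≤ suc s ] (term m s)                 ≡⟨ Σ-last s (term m s) ⟩
  Σ[0≤k≤ s ] (term m s) + term m s (suc s)  ≡⟨ cong (Σ[0≤k≤ s ] (term m s) +_) (term-above m s) ⟩
  Σ[0≤k≤ s ] (term m s) + 0                 ≡⟨ +-identityʳ _ ⟩
  Σ[0≤k≤ s ] (term m s)                     ∎
  where open ≡-Reasoning

Σ-term-zero : ∀ s n → Σ[0≤k≤ n ] (term 0 s) ≡ 1
Σ-term-zero s zero    = refl
Σ-term-zero s (suc n) = begin
  Σ[0≤k≤ suc n ] (term 0 s)                ≡⟨ Σ-last n (term 0 s) ⟩
  Σ[0≤k≤ n ] (term 0 s) + term 0 s (suc n) ≡⟨ cong₂ _+_ (Σ-term-zero s n) term≡0 ⟩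
  1                                        ∎
  where
  open ≡-Reasoning
  term≡0 : term 0 s (suc n) ≡ 0
  term≡0 = cong (_* 2 ^ suc n) (*-zeroʳ (s C suc n))

a≡Σ : ∀ m s → a m s ≡ Σ[0≤k≤ s ] (term m s)
a≡Σ zero    s       = sym (Σ-term-zero s s)
a≡Σ (suc m) zero    = refl
a≡Σ (suc m) (suc s) = begin
  a m (suc s) + a (suc m) s + a m s
    ≡⟨ cong₂ _+_ (cong₂ _+_ (a≡Σ m (suc s)) (a≡Σ (suc m) s)) (a≡Σ m s) ⟩
  X + Σ[0≤k≤ s ] (term (suc m) s) + Σ[0≤k≤ s ] (term m s)
    ≡⟨ cong₂ (λ y t → X + y + t) (Σ-above (suc m) s) (Σ-above m s) ⟨
  X + Σ[0≤k≤ suc s ] (term (suc m) s) + Σ[0≤k≤ suc s ] (term m s)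
    ≡⟨ Σ-pascal m s (suc s) ⟨
  L + 2 * term m s (suc s)
    -- The telescoping remainder vanishes because the range goes one past `s`.
    ≡⟨ cong (λ t → L + 2 * t) (term-above m s) ⟩
  L + 0
    ≡⟨ +-identityʳ L ⟩
  L ∎
  where
  open ≡-Reasoning
  L = Σ[0≤k≤ suc s ] (term (suc m) (suc s))
  X = Σ[0≤k≤ suc s ] (term m (suc s))

-- `a` matches on its first argument, so this does not hold by computation for a variable `m`.
a-zeroʳ : ∀ m → a m 0 ≡ 1
a-zeroʳ zero    = refl
a-zeroʳ (suc m) = refl

-- Inverse of the step towards zero. It raises the absolute value by one, and its image omits
-- exactly 0 and -1, the first coordinates that `ball` treats separately.
awayFromZero : ℤ → ℤ
awayFromZero (ℤ.+ n)  = +[1+ n ]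
awayFromZero -[1+ n ] = -[1+ suc n ]

stretch : Vec ℤ (suc m) → Vec ℤ (suc m)
stretch (z ∷ v) = awayFromZero z ∷ v

ball : ∀ m → ℕ → List (Vec ℤ m)
ball zero    s       = [ [] ]
ball (suc m) zero    = map (0ℤ ∷_) (ball m zero)
ball (suc m) (suc s) =
  (map (0ℤ ∷_) (ball m (suc s)) ++ map stretch (ball (suc m) s)) ++ map (-1ℤ ∷_) (ball m s)

length-ball : ∀ m s → length (ball m s) ≡ a m s
length-ball zero    s       = refl
length-ball (suc m) zero    =
  trans (length-map _ (ball m zero)) (trans (length-ball m zero) (a-zeroʳ m))
length-ball (suc m) (suc s) = begin
  length ((zeros ++ stretched) ++ minusOnes)            ≡⟨ length-++ (zeros ++ stretched) ⟩
  length (zeros ++ stretched) + length minusOnes        ≡⟨ cong (_+ length minusOnes) (length-++ zeros) ⟩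
  length zeros + length stretched + length minusOnes
    ≡⟨ cong₂ _+_ (cong₂ _+_ (length-map _ (ball m (suc s))) (length-map _ (ball (suc m) s)))
                 (length-map _ (ball m s)) ⟩
  length (ball m (suc s)) + length (ball (suc m) s) + length (ball m s)
    ≡⟨ cong₂ _+_ (cong₂ _+_ (length-ball m (suc s)) (length-ball (suc m) s)) (length-ball m s) ⟩
  a m (suc s) + a (suc m) s + a m s                     ∎
  where
  open ≡-Reasoning
  zeros stretched minusOnes : List (Vec ℤ (suc m))
  zeros     = map (0ℤ ∷_) (ball m (suc s))
  stretched = map stretch (ball (suc m) s)
  minusOnes = map (-1ℤ ∷_) (ball m s)

-- A nonzero first coordinate makes the norm a successor. Hence radius zero leaves only the
-- coordinate 0, and otherwise `s≤s` pays for lowering the radius by one.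
ball-complete : ∀ s (v : Vec ℤ m) → ∥ lookup v ∥₁ ≤ s → v ∈ ball m s
ball-complete s       []                 _         = here refl
ball-complete zero    (+0 ∷ v)           v≤s       = ∈-map⁺ (0ℤ ∷_) (ball-complete zero v v≤s)
ball-complete (suc s) (+0 ∷ v)           v≤s       =
  ∈-++⁺ˡ (∈-++⁺ˡ (∈-map⁺ (0ℤ ∷_) (ball-complete (suc s) v v≤s)))
ball-complete (suc s) (+[1+ k ] ∷ v)     (s≤s v≤s) =
  ∈-++⁺ˡ (∈-++⁺ʳ (map (0ℤ ∷_) (ball _ (suc s)))
    (∈-map⁺ stretch (ball-complete s (ℤ.+ k ∷ v) v≤s)))
ball-complete (suc s) (-[1+ zero ] ∷ v)  (s≤s v≤s) =
  ∈-++⁺ʳ (map (0ℤ ∷_) (ball _ (suc s)) ++ map stretch (ball _ s))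
    (∈-map⁺ (-1ℤ ∷_) (ball-complete s v v≤s))
ball-complete (suc s) (-[1+ suc k ] ∷ v) (s≤s v≤s) =
  ∈-++⁺ˡ (∈-++⁺ʳ (map (0ℤ ∷_) (ball _ (suc s)))
    (∈-map⁺ stretch (ball-complete s (-[1+ k ] ∷ v) v≤s)))

module _ {c ℓ} (G : AbelianGroup c ℓ) where
  open AbelianGroup G using (_≈_; monoid; reflexive)
    renaming (sym to ≈-sym; trans to ≈-trans)

  -- Coefficient functions that agree pointwise need not be propositionally equal, so they are
  -- tabulated as vectors, for which membership in `ball` can be established.
  ball-spans : ∀ {x} → Spans G {m} s x →
    ∀ g → ∃[ v ] (v ∈ ball m s × g ≈ linearCombination G (lookup v) x)
  ball-spans {s = s} {x} spans g with c , c≤s , g≈cx ← spans g =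
    tabulate c ,
    ball-complete s (tabulate c) (subst (_≤ s) norm-≡ c≤s) ,
    ≈-trans g≈cx (reflexive combination-≡)
    where
    norm-≡ : ∥ c ∥₁ ≡ ∥ lookup (tabulate c) ∥₁
    norm-≡ = MonoidSum.sum-cong-≗ +-0-monoid (cong ∣_∣ ∘ sym ∘ lookup∘tabulate c)

    combination-≡ : linearCombination G c x ≡ linearCombination G (lookup (tabulate c)) x
    combination-≡ = MonoidSum.sum-cong-≗ monoid
      (λ i → cong (λ z → _·_ G z (x i)) (sym (lookup∘tabulate c i)))

  -- Each group element is labelled by the position in the list of a coefficient vector representing
  -- it. The same position means the same vector, hence the same element, and the pigeonhole
  -- principle gives the bound.
  order≤length-ball : ∀ {x} → HasOrder G n → Spans G {m} s x → n ≤ length (ball m s)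
  order≤length-ball {n} {m} {s} {x} order spans = injective⇒≤ {f = label} label-injective
    where
    open Bijection order using (to; injective)

    coefficients : Fin n → Vec ℤ m
    coefficients i = proj₁ (ball-spans spans (to i))

    listed : ∀ i → coefficients i ∈ ball m s
    listed i = proj₁ (proj₂ (ball-spans spans (to i)))

    represents : ∀ i → to i ≈ linearCombination G (lookup (coefficients i)) x
    represents i = proj₂ (proj₂ (ball-spans spans (to i)))

    label : Fin n → Fin (length (ball m s))
    label i = index (listed i)

    label-injective : ∀ {i j} → label i ≡ label j → i ≡ j
    label-injective {i} {j} eq = injective (≈-trans (represents i) (≈-trans
      (reflexive (cong (λ v → linearCombination G (lookup v) x)
        (index-injective (setoid _) (listed i) (listed j) eq)))
      (≈-sym (represents j))))

theorem2 : (c ℓ : Level) (m s : ℕ) .{{_ : NonZero m}} .{{_ : NonZero s}} →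
    (a m s ≡ Σ[0≤k≤ s ] (λ k → (s C k) * (m C k) * 2 ^ k))
    × ((G : AbelianGroup c ℓ) (n : ℕ) → HasOrder G n → HasSpanningSet G s m → n ≤ a m s)
theorem2 c ℓ m s = a≡Σ m s , λ G n order (_ , _ , spans) →
  subst (n ≤_) (length-ball m s) (order≤length-ball G order spans)
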